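{- Let $L=(T,V,E)$ be a link stream and let $\Delta$ be a duration. Then Algorithm 1 (described in the context), run on input $(L,\Delta)$, computes the set of all maximal $\Delta$-cliques of $L$; that is, the set $R$ it returns is exactly the set of all maximal $\Delta$-cliques of $L$.
   Context: **Link streams.** A link stream is $L=(T,V,E)$ where $T=[\alpha,\omega]$ is a time interval, $V$ is a finite set of nodes and $E\subseteq T\times V\times V$ is a finite set of links; $(t,u,v)\in E$ means that $u$ and $v$ interact at time $t$. Links are undirected ($(t,u,v)$ and $(t,v,u)$ are not distinguished), there are no loops $(t,v,v)$, and no isolated nodes (every $v\in V$ occurs in some link $(t,u,v)\in E$). **$\Delta$-cliques.** For a duration $\Delta$, a $\Delta$-clique of $L$ is a pair $C=(X,[b,e])$ with $X\subseteq V$, $|X|\ge 2$, $[b,e]\subseteq T$, such that for all $\{u,v\}\subseteq X$ (with $u\neq v$) and all $\tau\in[b,\max(e-\Delta,b)]$ there is a link $(t,u,v)\in E$ with $t\in[\tau,\min(\tau+\Delta,e)]$. A $\Delta$-clique $C=(X,[b,e])$ is maximal if there is no $\Delta$-clique $C'=(X',[b',e'])\ne C$ with $X\subseteq X'$ and $[b,e]\subseteq[b',e']$. **Notation.** $f_{buv}$ is the smallest $t\ge b$ with $(t,u,v)\in E$; $l_{euv}$ is the largest $t\le e$ with $(t,u,v)\in E$. **Algorithm 1** (input: $L=(T,V,E)$ and $\Delta$; output: a set $R$). Initialize $S,R,M$ to $\emptyset$. For each $(t,u,v)\in E$, add $(\{u,v\},[t,t])$ to $S$ and to $M$. While $S\neq\emptyset$,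 do the following: 1. Take and remove an element $(X,[b,e])$ from $S$ (in arbitrary order), and set isMax to True. 2. For each $v\in V\setminus X$: if $(X\cup\{v\},[b,e])$ is a $\Delta$-clique, set isMax to False and, if $(X\cup\{v\},[b,e])\notin M$, add it to $S$ and $M$. 3. Let $f=\max_{u,v\in X,\,u\ne v} f_{buv}$ and $b'=f-\Delta$. If $b\neq b'$, set isMax to False and, if $(X,[b',e])\notin M$, add it to $S$ and $M$. 4. Let $l=\min_{u,v\in X,\,u\ne v} l_{euv}$ and $e'=l+\Delta$. If $e\neq e'$, set isMax to False and, if $(X,[b,e'])\notin M$, add it to $S$ and $M$. 5. If isMax is True, add $(X,[b,e])$ to $R$. When $S=\emptyset$, return $R$.
   Formalization: As stated the claim fails when a link is closer than Δ to an end of T (f−Δ or l+Δ leaves T); proved for Algorithm 1 when all links are at distance ≥ Δ from both ends, and always with f−Δ, l+Δ truncated to T. Time is any dense, decidably ordered abelian group; Δ ≥ 0. -}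

module Defs where

open import Algebra.Structures using (IsAbelianGroup)
import Algebra.Construct.NaturalChoice.Max as Max
import Algebra.Construct.NaturalChoice.Min as Min
open import Data.Bool using (Bool; true; false; if_then_else_)
import Data.Bool.Properties as Bool
open import Data.Fin using (Fin)
open import Data.Fin.Subset using (Subset; ∣_∣; _∪_; ⁅_⁆; _⊆_) renaming (_∈_ to _∈ˢ_)
open import Data.Fin.Subset.Properties using (_∈?_)
open import Data.List using (List; []; _∷_; map; filter; allFin)
open import Data.List.Membership.Propositional using (_∈_)
import Data.List.Membership.DecPropositional as DecMembership
open import Data.Nat using (ℕ)
import Data.Nat as ℕ
open import Data.Product using (_×_; _,_; ∃; ∃₂)
open import Data.Sum using (_⊎_)
import Data.Vec.Properties as Vec
open import Function using (flip; _⇔_)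
open import Induction.WellFounded using (Acc)
open import Level using (Level; suc; _⊔_)
open import Relation.Binary.Bundles using (TotalOrder)
open import Relation.Binary.Construct.Closure.ReflexiveTransitive using (Star)
import Relation.Binary.Construct.NonStrictToStrict as ToStrict
open import Relation.Binary.Core using (Rel)
open import Relation.Binary.Definitions using (Dense; DecidableEquality)
open import Relation.Binary.PropositionalEquality using (_≡_; _≢_; refl)
open import Relation.Binary.Structures using (IsDecTotalOrder)
open import Relation.Nullary using (¬_; does; ¬?)
open import Relation.Nullary.Decidable using (map′; _×-dec_)

-- The time axis. ℝ (classically) and ℚ are models. Density cannot be dropped:
-- over ℤ, the links (0,u,v) and (Δ+1,u,v) lie in one common Δ-clique
-- ({u,v},[-Δ,2Δ+1]), which the algorithm never finds.
record TimeAxis (c ℓ : Level) : Set (suc (c ⊔ ℓ)) where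
  infixl 6 _+_ _-_
  infix 8 -_
  infix 4 _≤_ _<_
  field
    Time            : Set c
    _≤_             : Rel Time ℓ
    _+_             : Time → Time → Time
    0#              : Time
    -_              : Time → Time
    isAbelianGroup  : IsAbelianGroup _≡_ _+_ 0# -_
    isDecTotalOrder : IsDecTotalOrder _≡_ _≤_
    +-monoʳ-≤       : ∀ x {y z} → y ≤ z → x + y ≤ x + z

  _<_ : Rel Time (c ⊔ ℓ)
  _<_ = ToStrict._<_ _≡_ _≤_

  field
    dense : Dense _<_

  _-_ : Time → Time → Time
  s - t = s + (- t)

  open IsDecTotalOrder isDecTotalOrder public
    using (_≟_; _≤?_; isTotalOrder)

  totalOrder : TotalOrder c c ℓ
  totalOrder = record { isTotalOrder = isTotalOrder }

  open Max totalOrder public using () renaming (_⊔_ to max)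
  open Min totalOrder public using () renaming (_⊓_ to min)

module _ {c ℓ : Level} (𝕋 : TimeAxis c ℓ) where
  open TimeAxis 𝕋

  -- V is Fin n. The finite set E is given by a list; order, repetitions and the
  -- orientation of the listed triples are irrelevant, see Link.
  record LinkStream : Set (c ⊔ ℓ) where
    field
      α ω : Time
      α≤ω : α ≤ ω
      n   : ℕ
      E   : List (Time × Fin n × Fin n)

    Link : Time → Fin n → Fin n → Set c
    Link t u v = (t , u , v) ∈ E ⊎ (t , v , u) ∈ E

    field
      inT        : ∀ {t u v} → Link t u v → α ≤ t × t ≤ ω
      noLoop     : ∀ {t v} → ¬ Link t v v
      noIsolated : ∀ v → ∃₂ λ t u → Link t u v

module Cliques {c ℓ : Level} (𝕋 : TimeAxis c ℓ) (L : LinkStream 𝕋) (Δ : TimeAxis.Time 𝕋) where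
  open TimeAxis 𝕋
  open LinkStream L

  record Candidate : Set c where
    constructor _,[_,_]
    field
      X   : Subset n
      b e : Time

  Distinct : Subset n → Fin n → Fin n → Set
  Distinct X u v = u ∈ˢ X × v ∈ˢ X × u ≢ v

  record IsClique (C : Candidate) : Set (c ⊔ ℓ) where
    open Candidate C
    field
      2≤∣X∣  : 2 ℕ.≤ ∣ X ∣
      b≤e    : b ≤ e
      α≤b    : α ≤ b
      e≤ω    : e ≤ ω
      linked : ∀ {u v} → Distinct X u v → ∀ τ → b ≤ τ → τ ≤ max (e - Δ) b →
               ∃ λ t → Link t u v × τ ≤ t × t ≤ min (τ + Δ) e

  _⊑_ : Candidate → Candidate → Set ℓ
  (X ,[ b , e ]) ⊑ (X′ ,[ b′ , e′ ]) = X ⊆ X′ × b′ ≤ b × e ≤ e′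

  IsMaximalClique : Candidate → Set (c ⊔ ℓ)
  IsMaximalClique C = IsClique C × ¬ ∃ λ C′ → IsClique C′ × C′ ≢ C × C ⊑ C′

  -- IsFirst b u v t  means  t = f_buv,  and  IsLast e u v t  means  t = l_euv.
  IsFirst IsLast : Time → Fin n → Fin n → Time → Set (c ⊔ ℓ)
  IsFirst b u v t = Link t u v × b ≤ t × (∀ {s} → Link s u v → b ≤ s → t ≤ s)
  IsLast  e u v t = Link t u v × t ≤ e × (∀ {s} → Link s u v → s ≤ e → s ≤ t)

  -- t = max f_buv, respectively t = min l_euv, over distinct u, v ∈ X; this
  -- includes the requirement that f_buv (l_euv) is defined for all such u, v.
  IsMaxFirst IsMinLast : Subset n → Time → Time → Set (c ⊔ ℓ)
  IsMaxFirst X b t =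
    (∃₂ λ u v → Distinct X u v × IsFirst b u v t) ×
    (∀ {u v} → Distinct X u v → ∃ λ s → IsFirst b u v s × s ≤ t)
  IsMinLast X e t =
    (∃₂ λ u v → Distinct X u v × IsLast e u v t) ×
    (∀ {u v} → Distinct X u v → ∃ λ s → IsLast e u v s × t ≤ s)

  _≟ᶜ_ : DecidableEquality Candidate
  (X ,[ b , e ]) ≟ᶜ (X′ ,[ b′ , e′ ]) =
    map′ (λ { (refl , refl , refl) → refl }) (λ { refl → refl , refl , refl })
      (Vec.≡-dec Bool._≟_ X X′ ×-dec (b ≟ b′ ×-dec e ≟ e′))

  open DecMembership _≟ᶜ_ using () renaming (_∈?_ to _∈ᶜ?_)

  -- S, R and M are finite sets represented by lists, read up to membership;
  -- accordingly removal deletes all occurrences.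
  _∖_ : List Candidate → Candidate → List Candidate
  S ∖ C = filter (λ D → ¬? (D ≟ᶜ C)) S

  record State : Set c where
    constructor state
    field
      S R M : List Candidate

  initial : State
  initial = state S₀ [] S₀
    where S₀ = map (λ { (t , u , v) → (⁅ u ⁆ ∪ ⁅ v ⁆) ,[ t , t ] }) E

  record Local : Set c where
    constructor local
    field
      isMax : Bool
      S M   : List Candidate

  found : Candidate → Local → Local
  found C (local _ S M) =
    if does (C ∈ᶜ? M) then local false S M else local false (C ∷ S) (C ∷ M)

  data NodeLoop (C : Candidate) : List (Fin n) → Local → Local → Set (c ⊔ ℓ) where
    done   : ∀ {σ} → NodeLoop C [] σ σ
    accept : ∀ {v vs σ σ′} → let open Candidate C; C⁺ = (X ∪ ⁅ v ⁆) ,[ b , e ] in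
             IsClique C⁺ → NodeLoop C vs (found C⁺ σ) σ′ → NodeLoop C (v ∷ vs) σ σ′
    reject : ∀ {v vs σ σ′} → let open Candidate C; C⁺ = (X ∪ ⁅ v ⁆) ,[ b , e ] in
             ¬ IsClique C⁺ → NodeLoop C vs σ σ′ → NodeLoop C (v ∷ vs) σ σ′

  outside : Subset n → List (Fin n)
  outside X = filter (λ v → ¬? (v ∈? X)) (allFin n)

  moveBegin moveEnd : Candidate → Time → Local → Local
  moveBegin (X ,[ b , e ]) b′ σ = if does (b ≟ b′) then σ else found (X ,[ b′ , e ]) σ
  moveEnd   (X ,[ b , e ]) e′ σ = if does (e ≟ e′) then σ else found (X ,[ b , e′ ]) σ

  commit : Candidate → List Candidate → Local → State
  commit C R (local isMax S M) = state S (if isMax then C ∷ R else R) M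

  -- The algorithm with b′ = back f and e′ = forth l.
  module Algorithm (back forth : Time → Time) where

    -- One pass through the while loop, with C the element taken from S.
    data Iteration (C : Candidate) : State → State → Set (c ⊔ ℓ) where
      iteration : ∀ {S R M σ f l} → let open Candidate C using (X; b; e) in
        C ∈ S →
        NodeLoop C (outside X) (local true (S ∖ C) M) σ →
        IsMaxFirst X b f →
        IsMinLast X e l →
        Iteration C (state S R M)
          (commit C R (moveEnd C (forth l) (moveBegin C (back f) σ)))

    _⟶_ : Rel State (c ⊔ ℓ)
    s ⟶ s′ = ∃ λ C → Iteration C s s′

    Reachable : State → Set (c ⊔ ℓ)
    Reachable = Star _⟶_ initial

    -- Whatever the order in which elements are taken from S: the run is finite,
    -- is never stuck while S is nonempty, and returns the maximal Δ-cliques.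
    record ComputesMaximalCliques : Set (c ⊔ ℓ) where
      field
        terminates : Acc (flip _⟶_) initial
        progress   : ∀ {s} → Reachable s → ∀ {C} → C ∈ State.S s → ∃ λ s′ → Iteration C s s′
        output     : ∀ {s} → Reachable s → State.S s ≡ [] →
                     ∀ C → C ∈ State.R s ⇔ IsMaximalClique C

  module Algorithm1 = Algorithm (λ f → f - Δ) (λ l → l + Δ)

  -- f - Δ and l + Δ may leave T = [α,ω]; here they are truncated to T.
  module Algorithm1InT = Algorithm (λ f → max α (f - Δ)) (λ l → min ω (l + Δ))

  -- No link is closer than Δ to an end of T. Where this fails, Algorithm1 returns
  -- some (X,[b,e]) with [b,e] ⊈ T, whereas Δ-cliques satisfy [b,e] ⊆ T. Where it
  -- holds, the truncations in Algorithm1InT have no effect.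
  Margin : Set (c ⊔ ℓ)
  Margin = ∀ {t u v} → Link t u v → α ≤ t - Δ × t + Δ ≤ ω

{-# OPTIONS --safe #-}

-- Density of time turns the quantification over all windows [τ,τ+Δ] into a finite
-- condition: some link falls within Δ of b, and each link not within Δ of e is
-- followed by another one within Δ. Cliqueness is therefore decidable, and a clique
-- which no step of the algorithm changes is maximal: a larger interval would need a
-- link in a stretch that the choice of f or l leaves empty. Conversely, each step
-- enlarges a clique to a clique, so a maximal clique that enters S is output, and
-- each one does enter S: it is built up from the last of its pairs to meet by one
-- move of the beginning, additions of nodes and moves of the end. Only finitely many
-- end points can arise, and a candidate enters S at most once, so every run is finite.
module Submission where

open import Defs
open import Algebra.Bundles using (Group)
import Algebra.Construct.NaturalChoice.Max as Max
import Algebra.Construct.NaturalChoice.Min as Min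
import Algebra.Properties.Group as GroupProperties
open import Algebra.Structures using (IsAbelianGroup)
open import Data.Bool using (true; false)
import Data.Bool.Properties as Bool
open import Data.Fin using (Fin)
import Data.Fin.Properties as Fin
import Data.Fin.Subset as Subset
open import Data.Fin.Subset using (Subset; ∣_∣; _∪_; ⁅_⁆; _⊆_; inside) renaming (_∈_ to _∈ˢ_; _∉_ to _∉ˢ_)
open import Data.Fin.Subset.Properties using (_∈?_; _⊆?_; nonempty?; Empty-unique; ∣⊥∣≡0; ∣⁅x⁆∣≡1; x∈⁅x⁆; x∈⁅y⁆⇒x≡y; p⊆q⇒∣p∣≤∣q∣; p⊂q⇒∣p∣<∣q∣; p⊆p∪q; q⊆p∪q; x∈p∪q⁻; ∪-comm; ⊆-refl; ⊆-antisym)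
open import Data.List using (List; []; _∷_; _++_; _∷ʳ_; map; filter; foldr; length; allFin; cartesianProductWith; cartesianProduct)
import Data.List.Extrema as Extrema
open import Data.List.Membership.Propositional using (_∈_; find; lose)
open import Data.List.Membership.Propositional.Properties using (∈-map⁺; ∈-map⁻; ∈-++⁺ˡ; ∈-++⁺ʳ; ∈-++⁻; ∈-filter⁺; ∈-filter⁻; ∈-allFin; ∈-cartesianProductWith⁺)
import Data.List.Membership.DecPropositional as DecMembership
open import Data.List.Properties using (filter-notAll; filter-idem; foldr-∷ʳ)
open import Data.List.Relation.Binary.Sublist.Propositional using () renaming (⊆-refl to ⊆ᴸ-refl)
import Data.List.Relation.Binary.Sublist.Propositional.Properties as Sublist
open import Data.List.Relation.Unary.All using (lookup)
open import Data.List.Relation.Unary.Any using (here; there; any?)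
import Data.Nat as ℕ
open import Data.Nat using (ℕ)
import Data.Nat.Induction as ℕ
import Data.Nat.Properties as ℕ
open import Data.Product using (_×_; _,_; ∃; ∃₂; proj₁; proj₂)
open import Data.Product.Properties using (≡-dec)
open import Data.Sum using (_⊎_; inj₁; inj₂; [_,_]′; swap)
open import Data.Vec using ([]; _∷_)
import Data.Vec.Properties as Vec
open import Function using (_∘_; flip; id; mk⇔)
open import Induction.WellFounded using (Acc; acc)
import Level
open import Level using (Level)
open import Relation.Binary.Bundles using (TotalOrder)
open import Relation.Binary.Construct.Closure.ReflexiveTransitive using (Star; ε; _◅_)
import Relation.Binary.Construct.Flip.EqAndOrd as Flip
import Relation.Binary.Construct.NonStrictToStrict as ToStrict
open import Relation.Binary.Core using (Rel)
open import Relation.Binary.PropositionalEquality using (_≡_; _≢_; refl; sym; trans; cong; subst)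
open import Relation.Binary.Structures using (IsDecTotalOrder)
open import Relation.Nullary using (¬_; Dec; yes; no; ¬?; contradiction)
open import Relation.Nullary.Decidable using (map′; _×-dec_; _⊎-dec_; _→-dec_; decidable-stable)
import Relation.Unary as Unary

-- Extrema and counting in lists.

module _ {c ℓ₁ ℓ₂} (O : TotalOrder c ℓ₁ ℓ₂) where
  open TotalOrder O using (Carrier; _≤_)
  open Extrema O using (argmax; argmax-sel; f[xs]≤f[argmax])

  maximum : ∀ {a p} {A : Set a} {P : A → Set p} → Unary.Decidable P → (key : A → Carrier) →
            ∀ {xs x} → x ∈ xs → P x →
            ∃ λ y → y ∈ xs × P y × (∀ {z} → z ∈ xs → P z → key z ≤ key y)
  maximum {P = P} P? key {xs} {x} x∈xs px =
    y , proj₁ y-ok , proj₂ y-ok , λ z∈xs pz → lookup (f[xs]≤f[argmax] x ys) (∈-filter⁺ P? z∈xs pz)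
    where
    -- The default value `x` of `argmax` satisfies `P` and lies in `xs`, so both outcomes of
    -- `argmax-sel` are acceptable.
    ys = filter P? xs
    y  = argmax key x ys
    y-ok : y ∈ xs × P y
    y-ok with argmax-sel key x ys
    ... | inj₁ y≡x  = subst (λ z → z ∈ xs × P z) (sym y≡x) (x∈xs , px)
    ... | inj₂ y∈ys = ∈-filter⁻ P? y∈ys

-- Filtering twice by `P?` is filtering once, so `filter P? xs` is a sublist of
-- `filter P? (filter Q? xs)`, which loses at least `x` from `filter Q? xs`. This makes the
-- termination measure go down.
length-filter-< : ∀ {a p q} {A : Set a} {P : A → Set p} {Q : A → Set q}
                  (P? : Unary.Decidable P) (Q? : Unary.Decidable Q) →
                  (∀ {x} → P x → Q x) → ∀ {x} xs → x ∈ xs → Q x → ¬ P x →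
                  length (filter P? xs) ℕ.< length (filter Q? xs)
length-filter-< P? Q? P⇒Q xs x∈xs qx ¬px = ℕ.≤-<-trans
  (ℕ.≤-trans
    (ℕ.≤-reflexive (cong length (sym (filter-idem P? xs))))
    (Sublist.length-mono-≤ (Sublist.filter⁺ P? P? (λ { refl → id })
      (Sublist.filter⁺ P? Q? (λ { refl → P⇒Q }) (⊆ᴸ-refl {x = xs})))))
  (filter-notAll P? _ (lose (∈-filter⁺ Q? x∈xs qx) ¬px))

-- Finite subsets.

subsets : ∀ n → List (Subset n)
subsets ℕ.zero    = [] ∷ []
subsets (ℕ.suc n) = map (inside ∷_) (subsets n) ++ map (Subset.outside ∷_) (subsets n)

∈-subsets : ∀ {n} (X : Subset n) → X ∈ subsets n
∈-subsets []          = here refl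
∈-subsets (true ∷ X)  = ∈-++⁺ˡ (∈-map⁺ (inside ∷_) (∈-subsets X))
∈-subsets (false ∷ X) = ∈-++⁺ʳ (map (inside ∷_) (subsets _)) (∈-map⁺ (Subset.outside ∷_) (∈-subsets X))

module _ {n : ℕ} where

  2≤⇒distinct : {X : Subset n} → 2 ℕ.≤ ∣ X ∣ → ∃₂ λ u v → u ∈ˢ X × v ∈ˢ X × u ≢ v
  2≤⇒distinct {X} 2≤∣X∣ with nonempty? X
  ... | no empty = contradiction 2≤∣X∣ (subst (λ Y → ¬ 2 ℕ.≤ ∣ Y ∣) (sym (Empty-unique empty))
                     λ 2≤0 → ℕ.<⇒≱ 2≤0 (ℕ.≤-trans (ℕ.≤-reflexive (∣⊥∣≡0 n)) ℕ.z≤n))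
  ... | yes (u , u∈X) with Fin.any? (λ v → v ∈? X ×-dec ¬? (u Fin.≟ v))
  ...   | yes (v , v∈X , u≢v) = u , v , u∈X , v∈X , u≢v
  ...   | no all≡u = contradiction 2≤∣X∣
            (ℕ.<⇒≱ (ℕ.s≤s (ℕ.≤-trans (p⊆q⇒∣p∣≤∣q∣ X⊆⁅u⁆) (ℕ.≤-reflexive (∣⁅x⁆∣≡1 u)))))
    where
    X⊆⁅u⁆ : X ⊆ ⁅ u ⁆
    X⊆⁅u⁆ {v} v∈X with u Fin.≟ v
    ... | yes refl = x∈⁅x⁆ u
    ... | no u≢v   = contradiction (v , v∈X , u≢v) all≡u

  ∣∪⁅⁆∣ : {X : Subset n} {v : Fin n} → v ∉ˢ X → ∣ X ∣ ℕ.< ∣ X ∪ ⁅ v ⁆ ∣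
  ∣∪⁅⁆∣ {X} {v} v∉X = p⊂q⇒∣p∣<∣q∣ (p⊆p∪q ⁅ v ⁆ , v , q⊆p∪q X ⁅ v ⁆ (x∈⁅x⁆ v) , v∉X)

  ∪⁅⁆-lub : {X Y : Subset n} {v : Fin n} → X ⊆ Y → v ∈ˢ Y → X ∪ ⁅ v ⁆ ⊆ Y
  ∪⁅⁆-lub {X} {Y} {v} X⊆Y v∈Y w∈ with x∈p∪q⁻ X ⁅ v ⁆ w∈
  ... | inj₁ w∈X   = X⊆Y w∈X
  ... | inj₂ w∈⁅v⁆ = subst (_∈ˢ Y) (sym (x∈⁅y⁆⇒x≡y v w∈⁅v⁆)) v∈Y

  ⊆-or-witness : (X Y : Subset n) → X ⊆ Y ⊎ ∃ λ v → v ∈ˢ X × v ∉ˢ Y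
  ⊆-or-witness X Y with Fin.any? (λ v → v ∈? X ×-dec ¬? (v ∈? Y))
  ... | yes w = inj₂ w
  ... | no ¬w = inj₁ λ {v} v∈X → decidable-stable (v ∈? Y) λ v∉Y → ¬w (v , v∈X , v∉Y)

-- Arithmetic and order of the time axis.

module TimeProperties {c ℓ} (𝕋 : TimeAxis c ℓ) where
  open TimeAxis 𝕋
  open IsDecTotalOrder isDecTotalOrder public
    using () renaming (refl to ≤-refl; trans to ≤-trans; antisym to ≤-antisym;
      reflexive to ≤-reflexive; total to ≤-total; ≤-respˡ-≈ to ≤-respˡ; ≤-respʳ-≈ to ≤-respʳ)
  open Max totalOrder public using (x≤x⊔y; x≤y⊔x; ⊔-lub; ⊔-sel; ⊔-monoʳ-≤; x≤y⇒x⊔y≈y)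
  open Min totalOrder public using (x⊓y≤x; x⊓y≤y; ⊓-glb; ⊓-sel; ⊓-monoʳ-≤; x≤y⇒y⊓x≈x)
  open IsAbelianGroup isAbelianGroup using (isGroup; identityʳ; comm)

  private
    G : Group c c
    G = record { isGroup = isGroup }

  <⇒≤ : ∀ {s t} → s < t → s ≤ t
  <⇒≤ = proj₁

  <⇒≱ : ∀ {s t} → s < t → ¬ t ≤ s
  <⇒≱ = ToStrict.<⇒≱ _≡_ _≤_ ≤-antisym

  ≰⇒> : ∀ {s t} → ¬ s ≤ t → t < s
  ≰⇒> = ToStrict.≰⇒> _≡_ _≤_ sym ≤-reflexive ≤-total

  ≮⇒≥ : ∀ {s t} → ¬ s < t → t ≤ s
  ≮⇒≥ {s} {t} s≮t = decidable-stable (t ≤? s) (s≮t ∘ ≰⇒>)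

  <-≤-trans : ∀ {r s t} → r < s → s ≤ t → r < t
  <-≤-trans = ToStrict.<-≤-trans _≡_ _≤_ sym ≤-trans ≤-antisym ≤-respʳ

  ≤-<-trans : ∀ {r s t} → r ≤ s → s < t → r < t
  ≤-<-trans = ToStrict.≤-<-trans _≡_ _≤_ ≤-trans ≤-antisym ≤-respˡ

  infix 4 _<?_
  _<?_ : ∀ s t → Dec (s < t)
  _<?_ = ToStrict.<-decidable _≡_ _≤_ _≟_ _≤?_

  +-monoˡ-≤ : ∀ x {y z} → y ≤ z → y + x ≤ z + x
  +-monoˡ-≤ x {y} {z} y≤z = ≤-trans (≤-reflexive (comm y x)) (≤-trans (+-monoʳ-≤ x y≤z) (≤-reflexive (comm x z)))

  -+-cancel : ∀ x y → (y - x) + x ≡ y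
  -+-cancel = GroupProperties.//-rightDividesˡ G

  +--cancel : ∀ x y → (y + x) - x ≡ y
  +--cancel = GroupProperties.//-rightDividesʳ G

  +-monoˡ-< : ∀ x {y z} → y < z → y + x < z + x
  +-monoˡ-< x {y} {z} (y≤z , y≢z) = +-monoˡ-≤ x y≤z , λ eq →
    y≢z (trans (sym (+--cancel x y)) (trans (cong (_- x) eq) (+--cancel x z)))

  ≤+⇒-≤ : ∀ {x y z} → x ≤ y + z → x - z ≤ y
  ≤+⇒-≤ {x} {y} {z} p = ≤-trans (+-monoˡ-≤ (- z) p) (≤-reflexive (+--cancel z y))

  -≤⇒≤+ : ∀ {x y z} → x - z ≤ y → x ≤ y + z
  -≤⇒≤+ {x} {y} {z} p = ≤-trans (≤-reflexive (sym (-+-cancel z x))) (+-monoˡ-≤ z p)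

  ≤-⇒+≤ : ∀ {x y z} → x ≤ y - z → x + z ≤ y
  ≤-⇒+≤ {x} {y} {z} p = ≤-trans (+-monoˡ-≤ z p) (≤-reflexive (-+-cancel z y))

  +<⇒<- : ∀ {x y z} → x + z < y → x < y - z
  +<⇒<- p = ≰⇒> (<⇒≱ p ∘ -≤⇒≤+)

  x≤x+y : ∀ {x y} → 0# ≤ y → x ≤ x + y
  x≤x+y {x} 0≤y = ≤-trans (≤-reflexive (sym (identityʳ x))) (+-monoʳ-≤ x 0≤y)

  ⊓-glb-< : ∀ {s x y} → s < x → s < y → s < min x y
  ⊓-glb-< {s} {x} {y} s<x s<y with ⊓-sel x y
  ... | inj₁ eq = subst (s <_) (sym eq) s<x
  ... | inj₂ eq = subst (s <_) (sym eq) s<y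

  -- The upper end `t` is lowered to each member of `ts` above `s` in turn, and density is applied
  -- to what remains. This is the point where density enters.
  gap : ∀ ts {s t} → s < t → ∃ λ τ → s < τ × τ < t × (∀ {r} → r ∈ ts → s < r → τ < r)
  gap [] s<t with τ , s<τ , τ<t ← dense s<t = τ , s<τ , τ<t , λ ()
  gap (r ∷ ts) {s} {t} s<t with s <? r
  ... | no s≮r with τ , s<τ , τ<t , below ← gap ts s<t =
        τ , s<τ , τ<t , λ { (here refl) s<r → contradiction s<r s≮r ; (there r∈) → below r∈ }
  ... | yes s<r with τ , s<τ , τ<m , below ← gap ts (⊓-glb-< s<t s<r) =
        τ , s<τ , <-≤-trans τ<m (x⊓y≤x t r) ,
        λ { (here refl) _ → <-≤-trans τ<m (x⊓y≤y t r) ; (there r∈) → below r∈ }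

-- Links, first and last links of pairs.

module CliqueProperties {c ℓ} (𝕋 : TimeAxis c ℓ) (L : LinkStream 𝕋) (Δ : TimeAxis.Time 𝕋)
                        (0≤Δ : TimeAxis._≤_ 𝕋 (TimeAxis.0# 𝕋) Δ) where
  open TimeAxis 𝕋
  open TimeProperties 𝕋
  open LinkStream L
  open Cliques 𝕋 L Δ

  times : List Time
  times = map proj₁ E

  link∈times : ∀ {t u v} → Link t u v → t ∈ times
  link∈times = [ ∈-map⁺ proj₁ , ∈-map⁺ proj₁ ]′

  link? : ∀ t u v → Dec (Link t u v)
  link? t u v = ((t , u , v) ∈ᴱ? E) ⊎-dec ((t , v , u) ∈ᴱ? E)
    where open DecMembership (≡-dec _≟_ (≡-dec Fin._≟_ Fin._≟_)) renaming (_∈?_ to _∈ᴱ?_)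

  link∃? : ∀ {p} {P : Time → Set p} u v → Unary.Decidable P → Dec (∃ λ t → Link t u v × P t)
  link∃? {P = P} u v P? = map′
    (λ meets → let t , _ , lk-pt = find {P = λ t → Link t u v × P t} meets in t , lk-pt)
    (λ { (t , lk , pt) → lose (link∈times lk) (lk , pt) })
    (any? (λ t → link? t u v ×-dec P? t) times)

  link∀? : ∀ {p} {P : Time → Set p} u v → Unary.Decidable P → Dec (∀ {t} → Link t u v → P t)
  link∀? u v P? = map′
    (λ none {t} lk → decidable-stable (P? t) λ ¬pt → none (t , lk , ¬pt))
    (λ { all (_ , lk , ¬pt) → ¬pt (all lk) })
    (¬? (link∃? u v (¬? ∘ P?)))

  distinct? : ∀ X u v → Dec (Distinct X u v)
  distinct? X u v = u ∈? X ×-dec v ∈? X ×-dec ¬? (u Fin.≟ v)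

  -- IsFirst and IsLast, as well as IsMaxFirst and IsMinLast, are instances of First
  -- and MaxFirst for the order ≤ and its converse.
  module Extremal {ℓ′} (_≼_ : Rel Time ℓ′) (isDTO : IsDecTotalOrder _≡_ _≼_) where
    private
      open IsDecTotalOrder isDTO using () renaming (_≤?_ to _≼?_; isTotalOrder to ≼-isTotalOrder;
        antisym to ≼-antisym; trans to ≼-trans; reflexive to ≼-reflexive)
      ≼-order : TotalOrder c c ℓ′
      ≼-order = record { isTotalOrder = ≼-isTotalOrder }

    First : Time → Fin n → Fin n → Time → Set _
    First b u v t = Link t u v × b ≼ t × (∀ {s} → Link s u v → b ≼ s → t ≼ s)

    MaxFirst : Subset n → Time → Time → Set _
    MaxFirst X b t =
      (∃₂ λ u v → Distinct X u v × First b u v t) ×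
      (∀ {u v} → Distinct X u v → ∃ λ s → First b u v s × s ≼ t)

    first? : ∀ b u v → Unary.Decidable (First b u v)
    first? b u v t = link? t u v ×-dec b ≼? t ×-dec link∀? u v (λ s → b ≼? s →-dec t ≼? s)

    first-exists : ∀ {b u v t} → Link t u v → b ≼ t → ∃ (First b u v)
    first-exists {b} {u} {v} lk b≼t
      -- A least element is a greatest one for the converse order.
      with s , _ , (lk′ , b≼s) , least ← maximum (Flip.totalOrder ≼-order)
             (λ s → link? s u v ×-dec b ≼? s) id (link∈times lk) (lk , b≼t)
      = s , lk′ , b≼s , λ lkᵣ b≼r → least (link∈times lkᵣ) (lkᵣ , b≼r)

    first-unique : ∀ {b u v s t} → First b u v s → First b u v t → s ≡ t
    first-unique (lkₛ , b≼s , leastₛ) (lkₜ , b≼t , leastₜ) =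
      ≼-antisym (leastₛ lkₜ b≼t) (leastₜ lkₛ b≼s)

    maxFirst-exists : ∀ {X b} → ∃₂ (Distinct X) →
                      (∀ {u v} → Distinct X u v → ∃ λ t → Link t u v × b ≼ t) → ∃ (MaxFirst X b)
    maxFirst-exists {X} {b} (u , v , d) links =
      -- The maximum runs over the finite list of link times, restricted to those that are the first
      -- link of some pair; the given pair supplies one.
      let t , _ , attained , greatest = maximum ≼-order attained? id (link∈times (proj₁ fst)) (u , v , d , fst)
      in  t , attained , λ {u′} {v′} d′ →
            let s , fst′ = firstOf d′ in s , fst′ , greatest (link∈times (proj₁ fst′)) (u′ , v′ , d′ , fst′)
      where
      attained? : Unary.Decidable λ t → ∃₂ λ u v → Distinct X u v × First b u v t
      attained? t = Fin.any? λ u → Fin.any? λ v → distinct? X u v ×-dec first? b u v t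
      firstOf : ∀ {u v} → Distinct X u v → ∃ (First b u v)
      firstOf d = let _ , lk , b≼t = links d in first-exists lk b≼t
      fst = proj₂ (firstOf d)

    maxFirst-unique : ∀ {X b s t} → MaxFirst X b s → MaxFirst X b t → s ≡ t
    maxFirst-unique ms mt = ≼-antisym (below ms mt) (below mt ms)
      where
      below : ∀ {X b s t} → MaxFirst X b s → MaxFirst X b t → s ≼ t
      below ((_ , _ , d , fst) , _) (_ , bound) =
        let _ , fst′ , r≼t = bound d in ≼-trans (≼-reflexive (first-unique fst fst′)) r≼t

  module First = Extremal _≤_ isDecTotalOrder
  module Last  = Extremal (flip _≤_) (Flip.isDecTotalOrder isDecTotalOrder)

  -- Cliqueness as a finite condition.

  Linked : Fin n → Fin n → Time → Time → Set _
  Linked u v b e = ∀ τ → b ≤ τ → τ ≤ max (e - Δ) b → ∃ λ t → Link t u v × τ ≤ t × t ≤ min (τ + Δ) e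

  -- Equivalent to `Linked`, but it only ranges over link times and is therefore decidable.
  Chain : Fin n → Fin n → Time → Time → Set _
  Chain u v b e =
    (∃ λ t → Link t u v × b ≤ t × t ≤ min (b + Δ) e) ×
    (∀ {t} → Link t u v → b ≤ t → t + Δ < e → ∃ λ s → Link s u v × t < s × s ≤ t + Δ)

  linked⇒chain : ∀ {u v b e} → Linked u v b e → Chain u v b e
  linked⇒chain {u} {v} {b} {e} linked = linked b ≤-refl (x≤y⊔x (e - Δ) b) , next
    where
    -- If no link followed t within Δ, then a window starting just after t,
    -- before every r - Δ > t with r a link time, would be empty.
    next : ∀ {t} → Link t u v → b ≤ t → t + Δ < e → ∃ λ s → Link s u v × t < s × s ≤ t + Δ
    next {t} _ b≤t t+Δ<e
      with τ , t<τ , τ<e-Δ , below ← gap (map (_- Δ) times) (+<⇒<- t+Δ<e)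
      with s , lk , τ≤s , s≤min ← linked τ (≤-trans b≤t (<⇒≤ t<τ)) (≤-trans (<⇒≤ τ<e-Δ) (x≤x⊔y (e - Δ) b))
      with s ≤? t + Δ
    ... | yes s≤t+Δ = s , lk , <-≤-trans t<τ τ≤s , s≤t+Δ
    ... | no  s≰t+Δ = contradiction (≤+⇒-≤ (≤-trans s≤min (x⊓y≤x (τ + Δ) e)))
                        (<⇒≱ (below (∈-map⁺ (_- Δ) (link∈times lk)) (+<⇒<- (≰⇒> s≰t+Δ))))

  -- If the chain starts before `τ`, its latest link `r` before `τ` has a successor within `Δ`,
  -- which by the choice of `r` cannot come before `τ`. As `b < τ`, the bound `τ + Δ` is strict;
  -- `begin-stuck` depends on this.
  chain-crosses : ∀ {u v b e τ} → Chain u v b e → b < τ → τ + Δ ≤ e →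
                  ∃ λ s → Link s u v × τ ≤ s × s < τ + Δ
  chain-crosses {u} {v} {b} {e} {τ} ((t , lk , b≤t , t≤min) , next) b<τ τ+Δ≤e with τ ≤? t
  ... | yes τ≤t = t , lk , τ≤t , ≤-<-trans (≤-trans t≤min (x⊓y≤x (b + Δ) e)) (+-monoˡ-< Δ b<τ)
  ... | no  τ≰t
    with r , _ , (lkᵣ , b≤r , r<τ) , latest ← maximum totalOrder (λ r → link? r u v ×-dec b ≤? r ×-dec r <? τ) id
           (link∈times lk) (lk , b≤t , ≰⇒> τ≰t)
    with s , lkₛ , r<s , s≤r+Δ ← next lkᵣ b≤r (<-≤-trans (+-monoˡ-< Δ r<τ) τ+Δ≤e)
    with s <? τ
  ...   | yes s<τ = contradiction (latest (link∈times lkₛ) (lkₛ , ≤-trans b≤r (<⇒≤ r<s) , s<τ)) (<⇒≱ r<s)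
  ...   | no  s≮τ = s , lkₛ , ≮⇒≥ s≮τ , ≤-<-trans s≤r+Δ (+-monoˡ-< Δ r<τ)

  chain⇒linked : ∀ {u v b e} → Chain u v b e → Linked u v b e
  chain⇒linked {b = b} {e} chain@(fst , _) τ b≤τ τ≤max with τ ≤? b
  ... | yes τ≤b with refl ← ≤-antisym b≤τ τ≤b = fst
  ... | no  τ≰b =
    let s , lk , τ≤s , s<τ+Δ = chain-crosses chain (≰⇒> τ≰b) τ+Δ≤e
    in  s , lk , τ≤s , ⊓-glb (<⇒≤ s<τ+Δ) (≤-trans (<⇒≤ s<τ+Δ) τ+Δ≤e)
    where
    -- As `τ` lies beyond `b`, the bound `max (e - Δ) b` on it must be `e - Δ`.
    τ+Δ≤e : τ + Δ ≤ e
    τ+Δ≤e with ⊔-sel (e - Δ) b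
    ... | inj₁ eq = ≤-⇒+≤ (≤-trans τ≤max (≤-reflexive eq))
    ... | inj₂ eq = contradiction (≤-trans τ≤max (≤-reflexive eq)) τ≰b

  chain? : ∀ u v b e → Dec (Chain u v b e)
  chain? u v b e =
    link∃? u v (λ t → b ≤? t ×-dec t ≤? min (b + Δ) e) ×-dec
    link∀? u v (λ t → b ≤? t →-dec t + Δ <? e →-dec link∃? u v (λ s → t <? s ×-dec s ≤? t + Δ))

  isClique? : Unary.Decidable IsClique
  isClique? (X ,[ b , e ]) = map′
    (λ { (2≤∣X∣ , b≤e , α≤b , e≤ω , chains) → record
         { 2≤∣X∣ = 2≤∣X∣ ; b≤e = b≤e ; α≤b = α≤b ; e≤ω = e≤ω
         ; linked = λ {u} {v} d → chain⇒linked (chains u v d) } })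
    (λ q → let open IsClique q in 2≤∣X∣ , b≤e , α≤b , e≤ω , λ u v d → linked⇒chain (linked d))
    (2 ℕ.≤? ∣ X ∣ ×-dec b ≤? e ×-dec α ≤? b ×-dec e ≤? ω ×-dec
     Fin.all? (λ u → Fin.all? λ v → distinct? X u v →-dec chain? u v b e))

  -- Restrictions of cliques, and the cliques given by single links.

  distinct-⊆ : ∀ {X Y u v} → X ⊆ Y → Distinct X u v → Distinct Y u v
  distinct-⊆ X⊆Y (u∈X , v∈X , u≢v) = X⊆Y u∈X , X⊆Y v∈X , u≢v

  clique-⊆ : ∀ {X Y b e} → IsClique (Y ,[ b , e ]) → X ⊆ Y → 2 ℕ.≤ ∣ X ∣ → IsClique (X ,[ b , e ])
  clique-⊆ q X⊆Y 2≤∣X∣ = record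
    { 2≤∣X∣ = 2≤∣X∣ ; b≤e = b≤e ; α≤b = α≤b ; e≤ω = e≤ω ; linked = linked ∘ distinct-⊆ X⊆Y }
    where open IsClique q using (b≤e; α≤b; e≤ω; linked)

  pair-link : ∀ {t u v} → Link t u v → ∀ {x y} → Distinct (⁅ u ⁆ ∪ ⁅ v ⁆) x y → Link t x y
  pair-link {u = u} {v} lk (x∈ , y∈ , x≢y) with x∈p∪q⁻ ⁅ u ⁆ ⁅ v ⁆ x∈ | x∈p∪q⁻ ⁅ u ⁆ ⁅ v ⁆ y∈
  ... | inj₁ p | inj₁ q = contradiction (trans (x∈⁅y⁆⇒x≡y u p) (sym (x∈⁅y⁆⇒x≡y u q))) x≢y
  ... | inj₂ p | inj₂ q = contradiction (trans (x∈⁅y⁆⇒x≡y v p) (sym (x∈⁅y⁆⇒x≡y v q))) x≢y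
  ... | inj₁ p | inj₂ q with refl ← x∈⁅y⁆⇒x≡y u p | refl ← x∈⁅y⁆⇒x≡y v q = lk
  ... | inj₂ p | inj₁ q with refl ← x∈⁅y⁆⇒x≡y v p | refl ← x∈⁅y⁆⇒x≡y u q = swap lk

  link-distinct : ∀ {t u v} → Link t u v → Distinct (⁅ u ⁆ ∪ ⁅ v ⁆) u v
  link-distinct {u = u} {v} lk = p⊆p∪q ⁅ v ⁆ (x∈⁅x⁆ u) , q⊆p∪q ⁅ u ⁆ ⁅ v ⁆ (x∈⁅x⁆ v) , λ { refl → noLoop lk }

  link-clique : ∀ {t u v} → Link t u v → IsClique ((⁅ u ⁆ ∪ ⁅ v ⁆) ,[ t , t ])
  link-clique {t} {u} {v} lk = record
    { 2≤∣X∣  = subst (ℕ._< ∣ ⁅ u ⁆ ∪ ⁅ v ⁆ ∣) (∣⁅x⁆∣≡1 u)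
                 (∣∪⁅⁆∣ λ v∈⁅u⁆ → proj₂ (proj₂ (link-distinct lk)) (sym (x∈⁅y⁆⇒x≡y u v∈⁅u⁆)))
    ; b≤e    = ≤-refl
    ; α≤b    = proj₁ (inT lk)
    ; e≤ω    = proj₂ (inT lk)
    -- Since `0 ≤ Δ`, the bound on `τ` is at most `t`: the only window starts at `t` and contains
    -- the link itself.
    ; linked = λ d τ t≤τ τ≤max → t , pair-link lk d ,
                 ≤-trans τ≤max (⊔-lub (≤+⇒-≤ (x≤x+y 0≤Δ)) ≤-refl) ,
                 ⊓-glb (≤-trans t≤τ (x≤x+y 0≤Δ)) ≤-refl
    }

  -- Moving the end points of a clique.

  module _ {X b e} (q : IsClique (X ,[ b , e ])) where
    open IsClique q

    maxFirst : ∃ (IsMaxFirst X b)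
    maxFirst = First.maxFirst-exists (2≤⇒distinct 2≤∣X∣) λ d →
      let t , lk , b≤t , _ = linked d b ≤-refl (x≤y⊔x (e - Δ) b) in t , lk , b≤t

    minLast : ∃ (IsMinLast X e)
    minLast = Last.maxFirst-exists (2≤⇒distinct 2≤∣X∣) λ d →
      let t , lk , _ , t≤ = linked d b ≤-refl (x≤y⊔x (e - Δ) b) in t , lk , ≤-trans t≤ (x⊓y≤y (b + Δ) e)

    maxFirst≤b+Δ : ∀ {f} → IsMaxFirst X b f → f ≤ b + Δ
    maxFirst≤b+Δ ((_ , _ , d , _ , _ , least) , _) =
      let _ , lk , b≤t , t≤ = linked d b ≤-refl (x≤y⊔x (e - Δ) b) in ≤-trans (least lk b≤t) (≤-trans t≤ (x⊓y≤x (b + Δ) e))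

    maxFirst≤e : ∀ {f} → IsMaxFirst X b f → f ≤ e
    maxFirst≤e ((_ , _ , d , _ , _ , least) , _) =
      let _ , lk , b≤t , t≤ = linked d b ≤-refl (x≤y⊔x (e - Δ) b) in ≤-trans (least lk b≤t) (≤-trans t≤ (x⊓y≤y (b + Δ) e))

    -- The last admissible window starts at `max (e - Δ) b` and contains a link of the pair that
    -- attains `l`.
    max≤minLast : ∀ {l} → IsMinLast X e l → max (e - Δ) b ≤ l
    max≤minLast ((_ , _ , d , _ , _ , greatest) , _) =
      let m = max (e - Δ) b
          _ , lk , m≤t , t≤ = linked d m (x≤y⊔x (e - Δ) b) ≤-refl
      in  ≤-trans m≤t (greatest lk (≤-trans t≤ (x⊓y≤y (m + Δ) e)))

    b≤minLast : ∀ {l} → IsMinLast X e l → b ≤ l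
    b≤minLast ml = ≤-trans (x≤y⊔x (e - Δ) b) (max≤minLast ml)

    e≤minLast+Δ : ∀ {l} → IsMinLast X e l → e ≤ l + Δ
    e≤minLast+Δ ml = -≤⇒≤+ (≤-trans (x≤x⊔y (e - Δ) b) (max≤minLast ml))

    -- A window that starts before `b`, but not before `b′`, contains the first link of each pair
    -- after `b`: that link comes no later than `f`, and `f ≤ b′ + Δ`.
    moveBegin-clique : ∀ {f} → IsMaxFirst X b f → IsClique (X ,[ max α (f - Δ) , e ]) × max α (f - Δ) ≤ b
    moveBegin-clique {f} mf = record
      { 2≤∣X∣ = 2≤∣X∣ ; b≤e = ≤-trans b′≤b b≤e ; α≤b = x≤x⊔y α (f - Δ) ; e≤ω = e≤ω ; linked = linked′ } , b′≤b
      where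
      b′ = max α (f - Δ)
      b′≤b : b′ ≤ b
      b′≤b = ⊔-lub α≤b (≤+⇒-≤ (maxFirst≤b+Δ mf))
      linked′ : ∀ {u v} → Distinct X u v → Linked u v b′ e
      linked′ d τ b′≤τ τ≤max with b ≤? τ
      ... | yes b≤τ = linked d τ b≤τ (≤-trans τ≤max (⊔-monoʳ-≤ (e - Δ) b′≤b))
      ... | no  b≰τ =
        let s , (lk , b≤s , _) , s≤f = proj₂ mf d
        in  s , lk , ≤-trans (<⇒≤ (≰⇒> b≰τ)) b≤s ,
            ⊓-glb (≤-trans s≤f (-≤⇒≤+ (≤-trans (x≤y⊔x α (f - Δ)) b′≤τ))) (≤-trans s≤f (maxFirst≤e mf))

    -- A new window starts after `e - Δ`, so it reaches up to `e`, and it starts no later than `l`.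
    -- It therefore contains the last link of each pair up to `e`.
    moveEnd-clique : ∀ {l} → IsMinLast X e l → IsClique (X ,[ b , min ω (l + Δ) ]) × e ≤ min ω (l + Δ)
    moveEnd-clique {l} ml = record
      { 2≤∣X∣ = 2≤∣X∣ ; b≤e = ≤-trans b≤e e≤e′ ; α≤b = α≤b ; e≤ω = x⊓y≤x ω (l + Δ) ; linked = linked′ } , e≤e′
      where
      e′ = min ω (l + Δ)
      e≤e′ : e ≤ e′
      e≤e′ = ⊓-glb e≤ω (e≤minLast+Δ ml)
      linked′ : ∀ {u v} → Distinct X u v → Linked u v b e′
      linked′ d τ b≤τ τ≤max with τ ≤? max (e - Δ) b
      ... | yes τ≤ =
        let t , lk , τ≤t , t≤ = linked d τ b≤τ τ≤ in t , lk , τ≤t , ≤-trans t≤ (⊓-monoʳ-≤ (τ + Δ) e≤e′)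
      ... | no  τ≰ =
        let s , (lk , s≤e , _) , l≤s = proj₂ ml d
            τ≤l = ≤-trans τ≤max (⊔-lub (≤+⇒-≤ (x⊓y≤y ω (l + Δ))) (b≤minLast ml))
        in  s , lk , ≤-trans τ≤l l≤s ,
            ⊓-glb (≤-trans s≤e (-≤⇒≤+ (≤-trans (x≤x⊔y (e - Δ) b) (<⇒≤ (≰⇒> τ≰))))) (≤-trans s≤e e≤e′)

    -- As `f - Δ ≤ b`, the only window left starts at `b`, and by time `f` every pair has met. This
    -- is the intermediate clique to which nodes are added in the completeness proof.
    chop-clique : ∀ {f} → IsMaxFirst X b f → IsClique (X ,[ b , f ])
    chop-clique {f} mf@((_ , _ , _ , lkf , b≤f , _) , _) = record
      { 2≤∣X∣ = 2≤∣X∣ ; b≤e = b≤f ; α≤b = α≤b ; e≤ω = proj₂ (inT lkf)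
      ; linked = λ d τ b≤τ τ≤max →
          let s , (lk , b≤s , _) , s≤f = proj₂ mf d
          in  s , lk , ≤-trans (≤-trans τ≤max (⊔-lub (≤+⇒-≤ (maxFirst≤b+Δ mf)) ≤-refl)) b≤s ,
              ⊓-glb (≤-trans s≤f (≤-trans (maxFirst≤b+Δ mf) (+-monoˡ-≤ Δ b≤τ))) s≤f }

  -- If `b` is `α`, there is no room before it. Otherwise `b + Δ ≡ f`, and the pair attaining `f`
  -- has no link in the half-open stretch from `b` to `f`, where `chain-crosses` would find one.
  begin-stuck : ∀ {X b b′ e′ f} → IsMaxFirst X b f → b ≡ max α (f - Δ) →
                α ≤ b′ → f ≤ e′ → (∀ {u v} → Distinct X u v → Linked u v b′ e′) → ¬ b′ < b
  begin-stuck {b = b} {b′} {e′} {f} ((_ , _ , d , _ , _ , least) , _) b≡ α≤b′ f≤e′ linked b′<b with ⊔-sel α (f - Δ)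
  ... | inj₁ eq = <⇒≱ b′<b (≤-trans (≤-reflexive (trans b≡ eq)) α≤b′)
  ... | inj₂ eq =
    let b+Δ≡f = trans (cong (_+ Δ) (trans b≡ eq)) (-+-cancel Δ f)
        s , lk , b≤s , s<b+Δ = chain-crosses (linked⇒chain (linked d)) b′<b (≤-trans (≤-reflexive b+Δ≡f) f≤e′)
    in  <⇒≱ s<b+Δ (≤-trans (≤-reflexive b+Δ≡f) (least lk b≤s))

  -- If `e` is `ω`, there is no room after it. Otherwise `l + Δ ≡ e < e′`, so the pair attaining `l`
  -- would meet again after `l` and no later than `e`, although `l` is its last link up to `e`.
  end-stuck : ∀ {X e b′ e′ l} → IsMinLast X e l → e ≡ min ω (l + Δ) →
              b′ ≤ l → e′ ≤ ω → (∀ {u v} → Distinct X u v → Linked u v b′ e′) → ¬ e < e′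
  end-stuck {e = e} {b′} {e′} {l} ((_ , _ , d , lkₗ , l≤e , greatest) , _) e≡ b′≤l e′≤ω linked e<e′ with ⊓-sel ω (l + Δ)
  ... | inj₁ eq = <⇒≱ e<e′ (≤-trans e′≤ω (≤-reflexive (sym (trans e≡ eq))))
  ... | inj₂ eq =
    let l+Δ≡e = sym (trans e≡ eq)
        s , lk , l<s , s≤l+Δ = proj₂ (linked⇒chain (linked d)) lkₗ b′≤l (≤-<-trans (≤-reflexive l+Δ≡e) e<e′)
    in  <⇒≱ l<s (greatest lk (≤-trans s≤l+Δ (≤-reflexive l+Δ≡e)))

-- Correctness for any `back` and `forth` that agree with the truncated moves at link times.

module Correctness {c ℓ} (𝕋 : TimeAxis c ℓ) (L : LinkStream 𝕋) (Δ : TimeAxis.Time 𝕋)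
                   (0≤Δ : TimeAxis._≤_ 𝕋 (TimeAxis.0# 𝕋) Δ)
                   (back forth : TimeAxis.Time 𝕋 → TimeAxis.Time 𝕋)
                   (back≡ : ∀ {t u v} → LinkStream.Link L t u v →
                            back t ≡ TimeAxis.max 𝕋 (LinkStream.α L) (TimeAxis._-_ 𝕋 t Δ))
                   (forth≡ : ∀ {t u v} → LinkStream.Link L t u v →
                             forth t ≡ TimeAxis.min 𝕋 (LinkStream.ω L) (TimeAxis._+_ 𝕋 t Δ)) where
  open TimeAxis 𝕋
  open LinkStream L
  open TimeProperties 𝕋
  open CliqueProperties 𝕋 L Δ 0≤Δ
  open Cliques 𝕋 L Δ
  open Algorithm back forth
  open DecMembership _≟ᶜ_ using () renaming (_∈?_ to _∈ᶜ?_)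

  infix 4 _↝_
  -- What processing a candidate finds, whether or not it is already in `M`: one constructor for
  -- each way in which a pass sets `isMax` to false.
  data _↝_ : Candidate → Candidate → Set (c Level.⊔ ℓ) where
    addNode   : ∀ {X b e v} → v ∉ˢ X → IsClique ((X ∪ ⁅ v ⁆) ,[ b , e ]) →
                (X ,[ b , e ]) ↝ ((X ∪ ⁅ v ⁆) ,[ b , e ])
    setBegin  : ∀ {X b e f} → IsMaxFirst X b f → b ≢ back f → (X ,[ b , e ]) ↝ (X ,[ back f , e ])
    setEnd    : ∀ {X b e l} → IsMinLast X e l → e ≢ forth l → (X ,[ b , e ]) ↝ (X ,[ b , forth l ])

  maxFirst-back : ∀ {X b f} → IsMaxFirst X b f → back f ≡ max α (f - Δ)
  maxFirst-back ((_ , _ , _ , lk , _) , _) = back≡ lk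

  minLast-forth : ∀ {X e l} → IsMinLast X e l → forth l ≡ min ω (l + Δ)
  minLast-forth ((_ , _ , _ , lk , _) , _) = forth≡ lk

  ↝-grows : ∀ {C D} → IsClique C → C ↝ D → IsClique D × D ≢ C × C ⊑ D
  ↝-grows _ (addNode {X} {v = v} v∉X q⁺) =
    q⁺ , (λ eq → v∉X (subst (v ∈ˢ_) (cong Candidate.X eq) (q⊆p∪q X ⁅ v ⁆ (x∈⁅x⁆ v)))) ,
    p⊆p∪q ⁅ v ⁆ , ≤-refl , ≤-refl
  ↝-grows q (setBegin mf b≢) rewrite maxFirst-back mf =
    let q′ , b′≤b = moveBegin-clique q mf
    in  q′ , (λ eq → b≢ (sym (cong Candidate.b eq))) , ⊆-refl , b′≤b , ≤-refl
  ↝-grows q (setEnd ml e≢) rewrite minLast-forth ml =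
    let q′ , e≤e′ = moveEnd-clique q ml
    in  q′ , (λ eq → e≢ (sym (cong Candidate.e eq))) , ⊆-refl , ≤-refl , e≤e′

  maximal⇒stuck : ∀ {C} → IsMaximalClique C → ∀ {D} → ¬ C ↝ D
  maximal⇒stuck (q , maximal) C↝D = maximal (_ , ↝-grows q C↝D)

  stuck-begin : ∀ {X b e f} → (∀ {D} → ¬ (X ,[ b , e ]) ↝ D) → IsMaxFirst X b f → b ≡ max α (f - Δ)
  stuck-begin {b = b} {f = f} stuck mf =
    trans (decidable-stable (b ≟ back f) (stuck ∘ setBegin mf)) (maxFirst-back mf)

  stuck-end : ∀ {X b e l} → (∀ {D} → ¬ (X ,[ b , e ]) ↝ D) → IsMinLast X e l → e ≡ min ω (l + Δ)
  stuck-end {e = e} {l} stuck ml =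
    trans (decidable-stable (e ≟ forth l) (stuck ∘ setEnd ml)) (minLast-forth ml)

  -- A larger clique links the pairs of `X` over its own interval, so `begin-stuck` and `end-stuck`
  -- force the intervals to agree. Then any further node of `X′` could be added to `X` alone.
  stuck⇒maximal : ∀ {C} → IsClique C → (∀ {D} → ¬ C ↝ D) → IsMaximalClique C
  stuck⇒maximal {X ,[ b , e ]} q stuck = q , λ { ((X′ ,[ b′ , e′ ]) , q′ , C′≢C , X⊆X′ , b′≤b , e≤e′) →
    let f , mf  = maxFirst q
        l , ml  = minLast q
        linked′ = λ {u} {v} d → IsClique.linked q′ {u} {v} (distinct-⊆ X⊆X′ d)
        b≤b′ = ≮⇒≥ (begin-stuck mf (stuck-begin stuck mf) (IsClique.α≤b q′) (≤-trans (maxFirst≤e q mf) e≤e′) linked′)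
        e′≤e = ≮⇒≥ (end-stuck ml (stuck-end stuck ml) (≤-trans b′≤b (b≤minLast q ml)) (IsClique.e≤ω q′) linked′)
    in  sameInterval X⊆X′ (≤-antisym b≤b′ b′≤b) (≤-antisym e≤e′ e′≤e) q′ C′≢C }
    where
    sameInterval : ∀ {X′ b′ e′} → X ⊆ X′ → b ≡ b′ → e ≡ e′ → IsClique (X′ ,[ b′ , e′ ]) →
                   ¬ (X′ ,[ b′ , e′ ]) ≢ (X ,[ b , e ])
    sameInterval {X′} X⊆X′ refl refl q′ C′≢C with ⊆-or-witness X′ X
    ... | inj₁ X′⊆X = C′≢C (cong (_,[ b , e ]) (⊆-antisym X′⊆X X⊆X′))
    ... | inj₂ (v , v∈X′ , v∉X) = stuck (addNode v∉X (clique-⊆ q′ (∪⁅⁆-lub X⊆X′ v∈X′)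
            (ℕ.≤-trans (IsClique.2≤∣X∣ q) (ℕ.<⇒≤ (∣∪⁅⁆∣ v∉X)))))

  -- A maximal clique (X,[b,e]) is reached from the last pair of X to meet for the
  -- first time after b, say at time f: [f,f] extends backwards to [b,f], then all
  -- nodes of X can be added, and finally the end moves forward to e without
  -- overshooting, since forth is monotone. As M is finite and closed, each of the
  -- last two phases amounts to considering a largest member of M.
  module Completeness (M : List Candidate)
    (cliques : ∀ {C} → C ∈ M → IsClique C)
    (links   : ∀ {t u v} → Link t u v → ((⁅ u ⁆ ∪ ⁅ v ⁆) ,[ t , t ]) ∈ M)
    (closed  : ∀ {C D} → C ∈ M → C ↝ D → D ∈ M) where

    closed-begin : ∀ {X b e f} → (X ,[ b , e ]) ∈ M → IsMaxFirst X b f → (X ,[ max α (f - Δ) , e ]) ∈ M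
    closed-begin {X} {b} {e} {f} C∈M mf = subst (λ b′ → (X ,[ b′ , e ]) ∈ M) (maxFirst-back mf) step
      where
      step : (X ,[ back f , e ]) ∈ M
      step with b ≟ back f
      ... | yes b≡ = subst (λ b′ → (X ,[ b′ , e ]) ∈ M) b≡ C∈M
      ... | no  b≢ = closed C∈M (setBegin mf b≢)

    closed-end : ∀ {X b e l} → (X ,[ b , e ]) ∈ M → IsMinLast X e l → (X ,[ b , min ω (l + Δ) ]) ∈ M
    closed-end {X} {b} {e} {l} C∈M ml = subst (λ e′ → (X ,[ b , e′ ]) ∈ M) (minLast-forth ml) step
      where
      step : (X ,[ b , forth l ]) ∈ M
      step with e ≟ forth l
      ... | yes e≡ = subst (λ e′ → (X ,[ b , e′ ]) ∈ M) e≡ C∈M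
      ... | no  e≢ = closed C∈M (setEnd ml e≢)

    -- For a single pair and the interval from `t` to `t`, the link at `t` is the first one, so `f`
    -- is `t`.
    link-begin : ∀ {t u v} → Link t u v → ((⁅ u ⁆ ∪ ⁅ v ⁆) ,[ max α (t - Δ) , t ]) ∈ M
    link-begin {t} {u} {v} lk = closed-begin (links lk)
      ( (u , v , link-distinct lk , lk , ≤-refl , λ _ → id)
      , λ d → t , (pair-link lk d , ≤-refl , λ _ → id) , ≤-refl )

    -- Take a largest `Z ⊆ X` in `M` with this interval; it need not contain `Y`. If it missed a
    -- node of `X`, adding that node would give a restriction of the clique on `X`, hence a larger
    -- member of `M`.
    addNodes : ∀ {X Y b e} → IsClique (X ,[ b , e ]) → Y ⊆ X → (Y ,[ b , e ]) ∈ M → (X ,[ b , e ]) ∈ M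
    addNodes {X} {Y} {b} {e} q Y⊆X C∈M
      with (Z ,[ _ , _ ]) , D∈M , (Z⊆X , refl , refl) , largest ← maximum ℕ.≤-totalOrder
             (λ D → let open Candidate D renaming (X to Xᴰ; b to bᴰ; e to eᴰ)
                    in  Xᴰ ⊆? X ×-dec b ≟ bᴰ ×-dec e ≟ eᴰ)
             (λ D → ∣ Candidate.X D ∣) C∈M (Y⊆X , refl , refl)
      with ⊆-or-witness X Z
    ... | inj₁ X⊆Z = subst (λ W → (W ,[ b , e ]) ∈ M) (⊆-antisym Z⊆X X⊆Z) D∈M
    ... | inj₂ (v , v∈X , v∉Z) = contradiction
          (largest (closed D∈M (addNode v∉Z (clique-⊆ q Z∪v⊆X
              (ℕ.≤-trans (IsClique.2≤∣X∣ (cliques D∈M)) (ℕ.<⇒≤ (∣∪⁅⁆∣ v∉Z))))))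
            (Z∪v⊆X , refl , refl))
          (ℕ.<⇒≱ (∣∪⁅⁆∣ v∉Z))
      where
      Z∪v⊆X : Z ∪ ⁅ v ⁆ ⊆ X
      Z∪v⊆X = ∪⁅⁆-lub Z⊆X v∈X

    -- Let `e₁` be the latest end in `M` up to `e`. Moving it cannot pass `e`, so by the choice of
    -- `e₁` it has no effect, and `end-stuck` excludes `e₁ < e`.
    moveEnds : ∀ {X b e e₀ l} → IsClique (X ,[ b , e ]) → IsMinLast X e l → e ≡ min ω (l + Δ) → e₀ ≤ e →
               (X ,[ b , e₀ ]) ∈ M → (X ,[ b , e ]) ∈ M
    moveEnds {X} {b} {e} {e₀} {l} q ml e≡ e₀≤e C∈M
      with (_ ,[ _ , e₁ ]) , D∈M , (refl , refl , e₁≤e) , latest ← maximum totalOrder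
             (λ D → let open Candidate D renaming (X to Xᴰ; b to bᴰ; e to eᴰ)
                    in  Vec.≡-dec Bool._≟_ X Xᴰ ×-dec b ≟ bᴰ ×-dec eᴰ ≤? e)
             Candidate.e C∈M (refl , refl , e₀≤e)
      with e ≤? e₁
    ... | yes e≤e₁ = subst (λ e′ → (X ,[ b , e′ ]) ∈ M) (≤-antisym e₁≤e e≤e₁) D∈M
    ... | no  e≰e₁ = contradiction (≰⇒> e≰e₁)
          (end-stuck ml₁ (≤-antisym e₁≤e₂ e₂≤e₁) (b≤minLast (cliques D∈M) ml₁) (IsClique.e≤ω q) (IsClique.linked q))
      where
      l₁  = proj₁ (minLast (cliques D∈M))
      ml₁ = proj₂ (minLast (cliques D∈M))
      l₁≤l : l₁ ≤ l
      l₁≤l =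
        -- For the pair that attains `l`, the last link up to `e₁` is also a link up to `e`.
        let (_ , _ , d , _ , _ , greatest) , _ = ml
            _ , (lk , s≤e₁ , _) , l₁≤s = proj₂ ml₁ d
        in  ≤-trans l₁≤s (greatest lk (≤-trans s≤e₁ e₁≤e))
      e₁≤e₂ : e₁ ≤ min ω (l₁ + Δ)
      e₁≤e₂ = proj₂ (moveEnd-clique (cliques D∈M) ml₁)
      e₂≤e₁ : min ω (l₁ + Δ) ≤ e₁
      e₂≤e₁ = latest (closed-end D∈M ml₁)
        (refl , refl , ≤-trans (⊓-monoʳ-≤ ω (+-monoˡ-≤ Δ l₁≤l)) (≤-reflexive (sym e≡)))

    maximal∈M : ∀ {C} → IsMaximalClique C → C ∈ M
    maximal∈M {X ,[ b , e ]} C-max@(q , _) =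
      let f , mf = maxFirst q
          l , ml = minLast q
          (u , v , (u∈X , v∈X , _) , lk , _) , _ = mf
          stuck : ∀ {D} → ¬ (X ,[ b , e ]) ↝ D
          stuck = maximal⇒stuck C-max
          ⁅u⁆⊆X = λ {w} w∈ → subst (_∈ˢ X) (sym (x∈⁅y⁆⇒x≡y {x = w} u w∈)) u∈X
      in  moveEnds q ml (stuck-end stuck ml) (maxFirst≤e q mf)
            (addNodes (chop-clique q mf) (∪⁅⁆-lub ⁅u⁆⊆X v∈X)
              -- A maximal clique is stuck, so `b` is exactly where the beginning lands when moved
              -- from `f`.
              (subst (λ b′ → ((⁅ u ⁆ ∪ ⁅ v ⁆) ,[ b′ , f ]) ∈ M) (sym (stuck-begin stuck mf)) (link-begin lk)))

  -- A finite supply of candidates and the termination measure.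

  begins ends : List Time
  begins = times ++ map back times
  ends   = times ++ map forth times

  universe : List Candidate
  universe = cartesianProductWith (λ { X (b , e) → X ,[ b , e ] }) (subsets n) (cartesianProduct begins ends)

  InUniverse : Candidate → Set c
  InUniverse (_ ,[ b , e ]) = b ∈ begins × e ∈ ends

  ∈-universe : ∀ {C} → InUniverse C → C ∈ universe
  ∈-universe {X ,[ _ , _ ]} (b∈ , e∈) =
    ∈-cartesianProductWith⁺ _ (∈-subsets X) (∈-cartesianProductWith⁺ _,_ b∈ e∈)

  -- Both `f` and `l` are times of links, so a moved end point never depends on the previous one
  -- beyond the choice of a link time.
  ↝-inUniverse : ∀ {C D} → C ↝ D → InUniverse C → InUniverse D
  ↝-inUniverse (addNode _ _) inU = inU
  ↝-inUniverse (setBegin ((_ , _ , _ , lk , _) , _) _) (_ , e∈) =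
    ∈-++⁺ʳ times (∈-map⁺ back (link∈times lk)) , e∈
  ↝-inUniverse (setEnd ((_ , _ , _ , lk , _) , _) _) (b∈ , _) =
    b∈ , ∈-++⁺ʳ times (∈-map⁺ forth (link∈times lk))

  fresh : List Candidate → List Candidate
  fresh M = filter (λ D → ¬? (D ∈ᶜ? M)) universe

  -- A candidate entering `S` and `M` adds one to the first term and takes at least one from the
  -- second; taking an element out of `S` makes the sum drop.
  measure : List Candidate → List Candidate → ℕ
  measure S M = length S ℕ.+ length (fresh M)

  -- The effect of one pass on `S` and `M`.

  record Extension (Ds S M S′ M′ : List Candidate) : Set (c Level.⊔ ℓ) where
    field
      S⊆S′  : ∀ {D} → D ∈ S → D ∈ S′
      M⊆M′  : ∀ {D} → D ∈ M → D ∈ M′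
      Ds⊆M′ : ∀ {D} → D ∈ Ds → D ∈ M′
      S′⇒   : ∀ {D} → D ∈ S′ → D ∈ S ⊎ D ∈ M′
      M′⇒M  : ∀ {D} → D ∈ M′ → D ∈ M ⊎ D ∈ Ds
      M′⇒S′ : ∀ {D} → D ∈ M′ → D ∈ M ⊎ D ∈ S′
      bound : (∀ {D} → D ∈ Ds → InUniverse D) → measure S′ M′ ℕ.≤ measure S M

  found-extends : ∀ Ds (σ : Local) → let open Local in
                  Extension Ds (S σ) (M σ) (S (foldr found σ Ds)) (M (foldr found σ Ds))
  found-extends [] _ = record
    { S⊆S′ = id ; M⊆M′ = id ; Ds⊆M′ = λ () ; S′⇒ = inj₁ ; M′⇒M = inj₁ ; M′⇒S′ = inj₁ ; bound = λ _ → ℕ.≤-refl }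
  found-extends (D ∷ Ds) σ with foldr found σ Ds | found-extends Ds σ
  ... | local _ S′ M′ | ext with D ∈ᶜ? M′
  ...   | yes D∈M′ = record
    { S⊆S′ = S⊆S′ ; M⊆M′ = M⊆M′
    ; Ds⊆M′ = λ { (here refl) → D∈M′ ; (there D∈) → Ds⊆M′ D∈ }
    ; S′⇒ = S′⇒
    ; M′⇒M = λ D∈ → [ inj₁ , inj₂ ∘ there ]′ (M′⇒M D∈)
    ; M′⇒S′ = M′⇒S′
    ; bound = λ inU → bound (inU ∘ there) }
    where open Extension ext
  ...   | no D∉M′ = record
    { S⊆S′ = there ∘ S⊆S′ ; M⊆M′ = there ∘ M⊆M′
    ; Ds⊆M′ = λ { (here refl) → here refl ; (there D∈) → there (Ds⊆M′ D∈) }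
    ; S′⇒ = λ { (here refl) → inj₂ (here refl) ; (there D∈) → [ inj₁ , inj₂ ∘ there ]′ (S′⇒ D∈) }
    ; M′⇒M = λ { (here refl) → inj₂ (here refl) ; (there D∈) → [ inj₁ , inj₂ ∘ there ]′ (M′⇒M D∈) }
    ; M′⇒S′ = λ { (here refl) → inj₂ (here refl) ; (there D∈) → [ inj₁ , inj₂ ∘ there ]′ (M′⇒S′ D∈) }
    -- The new `D` lengthens `S′` by one, but was fresh before and is no longer.
    ; bound = λ inU → ℕ.≤-trans
        (ℕ.≤-trans (ℕ.≤-reflexive (sym (ℕ.+-suc (length S′) _)))
          (ℕ.+-monoʳ-≤ (length S′) (length-filter-< _ _ (λ D∉ → D∉ ∘ there) universe
            (∈-universe (inU (here refl))) D∉M′ (λ D∉ → D∉ (here refl)))))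
        (bound (inU ∘ there)) }
    where open Extension ext

  -- Thus a pass outputs its clique exactly when its list of successors is empty; `step` splits on
  -- that list.
  found-isMax : ∀ D σ → Local.isMax (found D σ) ≡ false
  found-isMax D (local _ _ M) with D ∈ᶜ? M
  ... | yes _ = refl
  ... | no  _ = refl

  nodeLoop-finds : ∀ {C vs σ σ′} → let open Candidate C in NodeLoop C vs σ σ′ → ∃ λ Ds →
    σ′ ≡ foldr found σ Ds ×
    (∀ {D} → D ∈ Ds → ∃ λ v → v ∈ vs × D ≡ ((X ∪ ⁅ v ⁆) ,[ b , e ]) × IsClique D) ×
    (∀ {v} → v ∈ vs → IsClique ((X ∪ ⁅ v ⁆) ,[ b , e ]) → ((X ∪ ⁅ v ⁆) ,[ b , e ]) ∈ Ds)
  nodeLoop-finds done = [] , refl , (λ ()) , λ ()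
  nodeLoop-finds {C} {σ = σ} (accept {v} q loop) with Ds , eq , sound , complete ← nodeLoop-finds loop =
    -- `foldr` treats the last entry first, so the candidate accepted first goes to the end of the
    -- list.
    Ds ∷ʳ C⁺ , trans eq (sym (foldr-∷ʳ found σ C⁺ Ds)) ,
    (λ D∈ → [ (λ D∈Ds → let v , v∈ , rest = sound D∈Ds in v , there v∈ , rest)
            , (λ { (here refl) → v , here refl , refl , q }) ]′ (∈-++⁻ Ds D∈)) ,
    (λ { (here refl) _ → ∈-++⁺ʳ Ds (here refl) ; (there v∈) q′ → ∈-++⁺ˡ (complete v∈ q′) })
    where C⁺ = let open Candidate C in (X ∪ ⁅ v ⁆) ,[ b , e ]
  nodeLoop-finds (reject ¬q loop) with Ds , eq , sound , complete ← nodeLoop-finds loop =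
    Ds , eq , (λ D∈ → let v , v∈ , rest = sound D∈ in v , there v∈ , rest) ,
    λ { (here refl) q → contradiction q ¬q ; (there v∈) → complete v∈ }

  nodeLoop-runs : ∀ C vs σ → ∃ (NodeLoop C vs σ)
  nodeLoop-runs C [] σ = σ , done
  nodeLoop-runs C@(X ,[ b , e ]) (v ∷ vs) σ with isClique? ((X ∪ ⁅ v ⁆) ,[ b , e ])
  ... | yes q = let σ′ , loop = nodeLoop-runs C vs (found ((X ∪ ⁅ v ⁆) ,[ b , e ]) σ) in σ′ , accept q loop
  ... | no ¬q = let σ′ , loop = nodeLoop-runs C vs σ in σ′ , reject ¬q loop

  Successors : Candidate → List Candidate → Set _
  Successors C Ds = (∀ {D} → D ∈ Ds → C ↝ D) × (∀ {D} → C ↝ D → D ∈ Ds)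

  moveBegin-finds : ∀ {X b e} b′ Ds σ → ∃ λ Ds′ →
    moveBegin (X ,[ b , e ]) b′ (foldr found σ Ds) ≡ foldr found σ (Ds′ ++ Ds) ×
    (∀ {D} → D ∈ Ds′ → D ≡ (X ,[ b′ , e ]) × b ≢ b′) × (b ≢ b′ → (X ,[ b′ , e ]) ∈ Ds′)
  moveBegin-finds {b = b} b′ Ds σ with b ≟ b′
  ... | yes b≡ = [] , refl , (λ ()) , λ b≢ → contradiction b≡ b≢
  ... | no  b≢ = _ ∷ [] , refl , (λ { (here refl) → refl , b≢ }) , λ _ → here refl

  moveEnd-finds : ∀ {X b e} e′ Ds σ → ∃ λ Ds′ →
    moveEnd (X ,[ b , e ]) e′ (foldr found σ Ds) ≡ foldr found σ (Ds′ ++ Ds) ×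
    (∀ {D} → D ∈ Ds′ → D ≡ (X ,[ b , e′ ]) × e ≢ e′) × (e ≢ e′ → (X ,[ b , e′ ]) ∈ Ds′)
  moveEnd-finds {e = e} e′ Ds σ with e ≟ e′
  ... | yes e≡ = [] , refl , (λ ()) , λ e≢ → contradiction e≡ e≢
  ... | no  e≢ = _ ∷ [] , refl , (λ { (here refl) → refl , e≢ }) , λ _ → here refl

  body-finds : ∀ {X b e f l σ₀ σ} → let C = X ,[ b , e ] in
    NodeLoop C (outside X) σ₀ σ → IsMaxFirst X b f → IsMinLast X e l →
    ∃ λ Ds → moveEnd C (forth l) (moveBegin C (back f) σ) ≡ foldr found σ₀ Ds × Successors C Ds
  body-finds {X} {b} {e} {f} {l} {σ₀} loop mf ml
    with Ds₁ , refl , sound₁ , complete₁ ← nodeLoop-finds loop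
    with Ds₂ , eq₂ , sound₂ , complete₂ ← moveBegin-finds {X} {b} {e} (back f) Ds₁ σ₀
    with Ds₃ , eq₃ , sound₃ , complete₃ ← moveEnd-finds {X} {b} {e} (forth l) (Ds₂ ++ Ds₁) σ₀
    = Ds₃ ++ Ds₂ ++ Ds₁ , trans (cong (moveEnd _ (forth l)) eq₂) eq₃ , sound , complete
    where
    outside? = λ v → ¬? (v ∈? X)
    sound : ∀ {D} → D ∈ Ds₃ ++ Ds₂ ++ Ds₁ → (X ,[ b , e ]) ↝ D
    sound D∈ with ∈-++⁻ Ds₃ D∈
    ... | inj₁ D∈₃ with refl , e≢ ← sound₃ D∈₃ = setEnd ml e≢
    ... | inj₂ D∈ with ∈-++⁻ Ds₂ D∈
    ...   | inj₁ D∈₂ with refl , b≢ ← sound₂ D∈₂ = setBegin mf b≢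
    ...   | inj₂ D∈₁ with v , v∈ , refl , q ← sound₁ D∈₁ = addNode (proj₂ (∈-filter⁻ outside? {xs = allFin n} v∈)) q
    complete : ∀ {D} → (X ,[ b , e ]) ↝ D → D ∈ Ds₃ ++ Ds₂ ++ Ds₁
    complete (addNode v∉X q) = ∈-++⁺ʳ Ds₃ (∈-++⁺ʳ Ds₂ (complete₁ (∈-filter⁺ outside? (∈-allFin _) v∉X) q))
    -- The move may come with its own `f`; uniqueness identifies it with the one computed by the
    -- pass.
    complete (setBegin mf′ b≢) with refl ← First.maxFirst-unique mf mf′ = ∈-++⁺ʳ Ds₃ (∈-++⁺ˡ (complete₂ b≢))
    complete (setEnd ml′ e≢) with refl ← Last.maxFirst-unique ml ml′ = ∈-++⁺ˡ (complete₃ e≢)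

  -- The loop invariant.

  record Invariant (s : State) : Set (c Level.⊔ ℓ) where
    open State s
    field
      S⊆M       : ∀ {C} → C ∈ S → C ∈ M
      cliques   : ∀ {C} → C ∈ M → IsClique C
      bounded   : ∀ {C} → C ∈ M → InUniverse C
      links     : ∀ {t u v} → Link t u v → ((⁅ u ⁆ ∪ ⁅ v ⁆) ,[ t , t ]) ∈ M
      -- Once `S` is empty, this says that `M` is closed under `↝` and that its maximal members are
      -- in `R`, as needed to conclude from `Completeness`.
      processed : ∀ {C} → C ∈ M → C ∈ S ⊎ (∀ {D} → C ↝ D → D ∈ M) × (IsMaximalClique C → C ∈ R)
      sound     : ∀ {C} → C ∈ R → IsMaximalClique C

  initial-invariant : Invariant initial
  initial-invariant = record
    { S⊆M = id
    ; cliques = λ C∈ → case-initial IsClique link-clique C∈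
    ; bounded = λ C∈ → case-initial InUniverse (λ lk → ∈-++⁺ˡ (link∈times lk) , ∈-++⁺ˡ (link∈times lk)) C∈
    ; links = λ { (inj₁ t∈) → ∈-map⁺ _ t∈
                -- The link is listed with the other orientation, which gives the same pair as a
                -- set.
                ; {t} {u} {v} (inj₂ t∈) → subst (λ Y → (Y ,[ t , t ]) ∈ State.M initial) (∪-comm ⁅ v ⁆ ⁅ u ⁆) (∈-map⁺ _ t∈) }
    ; processed = inj₁
    ; sound = λ () }
    where
    case-initial : ∀ {p} (P : Candidate → Set p) → (∀ {t u v} → Link t u v → P ((⁅ u ⁆ ∪ ⁅ v ⁆) ,[ t , t ])) →
                   ∀ {C} → C ∈ State.M initial → P C
    case-initial P p C∈ with _ , t∈ , refl ← ∈-map⁻ _ C∈ = p (inj₁ t∈)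

  step : ∀ {s s′} → Invariant s → s ⟶ s′ →
         Invariant s′ × measure (State.S s′) (State.M s′) ℕ.< measure (State.S s) (State.M s)
  step inv (C , iteration {S} {R} {M} C∈S loop mf ml)
    with Ds , eq , ↝⁻ , ↝⁺ ← body-finds loop mf ml
    rewrite eq = record
      { S⊆M = λ D∈S′ → [ M⊆M′ ∘ S⊆M ∘ proj₁ ∘ ∈-filter⁻ (λ D → ¬? (D ≟ᶜ C)) , id ]′ (S′⇒ D∈S′)
      ; cliques = λ D∈M′ → [ cliques , proj₁ ∘ ↝-grows q ∘ ↝⁻ ]′ (M′⇒M D∈M′)
      ; bounded = λ D∈M′ → [ bounded , inU ]′ (M′⇒M D∈M′)
      ; links = M⊆M′ ∘ links
      ; processed = processed′
      ; sound = sound′ Ds ↝⁺ }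
    -- Finding successors does not raise the measure, and the removal of `C` has lowered it.
    , ℕ.≤-<-trans (bound inU)
        (ℕ.+-monoˡ-< (length (fresh M)) (filter-notAll _ S (lose C∈S λ C≢C → C≢C refl)))
    where
    open Invariant inv
    σ₀ = local true (S ∖ C) M
    open Extension (found-extends Ds σ₀)
    q = cliques (S⊆M C∈S)

    inU : ∀ {D} → D ∈ Ds → InUniverse D
    inU D∈ = ↝-inUniverse (↝⁻ D∈) (bounded (S⊆M C∈S))

    -- The list of successors is an argument here so that a case split on it determines the flag
    -- `isMax`.
    output : List Candidate → List Candidate
    output Ds = State.R (commit C R (foldr found σ₀ Ds))

    R⊆R′ : ∀ Ds {D} → D ∈ R → D ∈ output Ds
    R⊆R′ [] = there
    R⊆R′ (D ∷ Ds) rewrite found-isMax D (foldr found σ₀ Ds) = id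

    sound′ : ∀ Ds → (∀ {D} → C ↝ D → D ∈ Ds) → ∀ {D} → D ∈ output Ds → IsMaximalClique D
    sound′ [] ↝⁺ (here refl) = stuck⇒maximal q (λ C↝D → contradiction (↝⁺ C↝D) λ ())
    sound′ [] ↝⁺ (there D∈R) = sound D∈R
    sound′ (D ∷ Ds) _ rewrite found-isMax D (foldr found σ₀ Ds) = sound

    maximal-output : ∀ Ds → (∀ {D} → D ∈ Ds → C ↝ D) → IsMaximalClique C → C ∈ output Ds
    maximal-output [] _ _ = here refl
    maximal-output (D ∷ Ds) ↝⁻ C-max = contradiction (↝⁻ (here refl)) (maximal⇒stuck C-max)

    processed′ : ∀ {D} → D ∈ Local.M (foldr found σ₀ Ds) → D ∈ Local.S (foldr found σ₀ Ds) ⊎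
                 (∀ {D′} → D ↝ D′ → D′ ∈ Local.M (foldr found σ₀ Ds)) × (IsMaximalClique D → D ∈ output Ds)
    processed′ {D} D∈M′ with M′⇒S′ D∈M′
    ... | inj₂ D∈S′ = inj₁ D∈S′
    ... | inj₁ D∈M with processed D∈M
    ...   | inj₂ (closed , complete) = inj₂ (M⊆M′ ∘ closed , R⊆R′ Ds ∘ complete)
    ...   | inj₁ D∈S with D ≟ᶜ C
    ...     | yes refl = inj₂ (Ds⊆M′ ∘ ↝⁺ , maximal-output Ds ↝⁻)
    ...     | no  D≢C  = inj₁ (S⊆S′ (∈-filter⁺ (λ D → ¬? (D ≟ᶜ C)) D∈S D≢C))

  reachable-invariant : ∀ {s s′} → Invariant s → Star _⟶_ s s′ → Invariant s′
  reachable-invariant inv ε = inv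
  reachable-invariant inv (s⟶ ◅ rest) = reachable-invariant (proj₁ (step inv s⟶)) rest

  accessible : ∀ {s} → Invariant s → Acc ℕ._<_ (measure (State.S s) (State.M s)) → Acc (flip _⟶_) s
  accessible inv (acc rs) = acc λ s⟶ → let inv′ , less = step inv s⟶ in accessible inv′ (rs less)

  -- Termination, progress and output of every run.

  computesMaximalCliques : ComputesMaximalCliques
  computesMaximalCliques = record
    { terminates = accessible initial-invariant (ℕ.<-wellFounded _)
    ; progress   = λ {s} reach {C} C∈S →
        let open Invariant (reachable-invariant initial-invariant reach)
            q = cliques (S⊆M C∈S)
        in  _ , iteration C∈S (proj₂ (nodeLoop-runs C _ _)) (proj₂ (maxFirst q)) (proj₂ (minLast q))
    ; output     = λ { {state _ R M} reach refl C →
        let open Invariant (reachable-invariant initial-invariant reach)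
            processed-all : ∀ {C} → C ∈ M → (∀ {D} → C ↝ D → D ∈ M) × (IsMaximalClique C → C ∈ R)
            processed-all = λ C∈M → [ (λ ()) , id ]′ (processed C∈M)
            open Completeness M cliques links (λ C∈M → proj₁ (processed-all C∈M))
        in  mk⇔ sound λ C-max → proj₂ (processed-all (maximal∈M C-max)) C-max }
    }

theorem1 : ∀ {c ℓ : Level} (𝕋 : TimeAxis c ℓ) (L : LinkStream 𝕋) (Δ : TimeAxis.Time 𝕋) →
    TimeAxis._≤_ 𝕋 (TimeAxis.0# 𝕋) Δ →
    (Cliques.Margin 𝕋 L Δ → Cliques.Algorithm1.ComputesMaximalCliques 𝕋 L Δ)
    × Cliques.Algorithm1InT.ComputesMaximalCliques 𝕋 L Δ
theorem1 𝕋 L Δ 0≤Δ =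
  -- Under the margin, truncation to `T` changes neither `t - Δ` nor `t + Δ` for a link time `t`,
  -- and `Correctness` asks for agreement at such times only.
  (λ margin → Correctness.computesMaximalCliques 𝕋 L Δ 0≤Δ _ _
     (λ lk → sym (x≤y⇒x⊔y≈y (proj₁ (margin lk))))
     (λ lk → sym (x≤y⇒y⊓x≈x (proj₂ (margin lk))))) ,
  Correctness.computesMaximalCliques 𝕋 L Δ 0≤Δ _ _ (λ _ → refl) (λ _ → refl)
  where open TimeProperties 𝕋
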